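{- Let $\Gamma$ be a directed graph on the node set $[k]$. If $\Gamma$ is acyclic then the map $\kappa$, sending a face $F$ of the braid cone $Q(\Gamma,\mathbf 0)$ to $F\cap[0,1]^k$, is a poset isomorphism from the poset of faces of $Q(\Gamma,\mathbf 0)$ to the face figure $\mathcal F_{01}$ of the face $F_{01}$ of the order polytope $\operatorname{Ord}(\Gamma)$.
   Context: The braid cone is $Q(\Gamma,\mathbf 0)=\{x\in\mathbb R^k : x_i\le x_j\text{ for all arcs }(i,j)\in\Gamma\}$; its faces are its nonempty faces (including itself), ordered by inclusion. For acyclic $\Gamma$, the order polytope is $\operatorname{Ord}(\Gamma)=Q(\Gamma,\mathbf 0)\cap[0,1]^k$, i.e. the order polytope of the partial order on $[k]$ generated by the arcs of $\Gamma$. It contains $\mathbf 0=(0,\dots,0)$ and $\mathbf 1=(1,\dots,1)$ as vertices, and $F_{01}$ denotes the unique minimal face of $\operatorname{Ord}(\Gamma)$ containing both of them. The face figure $\mathcal F_{01}$ is the principal filter of $F_{01}$ in the face poset of $\operatorname{Ord}(\Gamma)$, i.e. the set of all faces of $\operatorname{Ord}(\Gamma)$ (including $\operatorname{Ord}(\Gamma)$ itself) containing $F_{01}$, ordered by inclusion. -}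

module Defs where

open import Algebra.Bundles using (CommutativeRing)
open import Data.Fin.Base using (Fin)
open import Data.Nat.Base using (ℕ)
open import Data.Product.Base using (Σ-syntax; ∃-syntax; _×_; proj₁)
open import Data.Vec.Functional using (Vector; replicate)
open import Level using (0ℓ; suc)
open import Relation.Binary.Bundles using (Poset)
open import Relation.Binary.Construct.Closure.Transitive using (TransClosure)
import Relation.Binary.Construct.On as On
open import Relation.Binary.Core using (Rel)
open import Relation.Binary.Definitions using (Decidable)
open import Relation.Binary.Structures using (IsTotalOrder)
open import Relation.Nullary.Negation.Core using (¬_)
open import Relation.Unary using (Pred; _∈_; _⊆_; _≐_; _∩_; Satisfiable)
open import Relation.Unary.Relation.Binary.Subset using (⊆-poset)

-- The real numbers are given axiomatically, as a Dedekind-complete totally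
-- ordered field; classically these axioms determine ℝ up to isomorphism.
-- Equality is a setoid equality, so that Cauchy sequences may serve as elements.
record RealNumbers : Set (suc 0ℓ) where
  field
    commutativeRing : CommutativeRing 0ℓ 0ℓ

  open CommutativeRing commutativeRing public
    using (Carrier; _≈_; _+_; _*_; -_; 0#; 1#; +-rawMonoid)

  infix 4 _≤_

  field
    _≤_          : Rel Carrier 0ℓ
    isTotalOrder : IsTotalOrder _≈_ _≤_
    0≉1          : ¬ (0# ≈ 1#)
    inverse      : ∀ x → ¬ (x ≈ 0#) → ∃[ y ] x * y ≈ 1#
    +-monoʳ-≤    : ∀ x {y z} → y ≤ z → x + y ≤ x + z
    *-nonNeg     : ∀ {x y} → 0# ≤ x → 0# ≤ y → 0# ≤ x * y

  IsUpperBound : Pred Carrier 0ℓ → Pred Carrier 0ℓ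
  IsUpperBound S b = ∀ {x} → x ∈ S → x ≤ b

  field
    complete : ∀ S → Satisfiable S → Satisfiable (IsUpperBound S) →
               ∃[ s ] IsUpperBound S s × (∀ {b} → IsUpperBound S b → s ≤ b)

-- A directed graph on the node set [k], with arc set a (decidable) subset of
-- [k] × [k].
record Digraph (k : ℕ) : Set (suc 0ℓ) where
  field
    Arc  : Rel (Fin k) 0ℓ
    arc? : Decidable Arc

-- TransClosure Arc i j: there is a directed walk of length at least one from i to j.
Acyclic : ∀ {k} → Digraph k → Set
Acyclic Γ = ∀ i → ¬ TransClosure (Digraph.Arc Γ) i i

module Polyhedra (R : RealNumbers) where

  open RealNumbers R
  open import Algebra.Definitions.RawMonoid +-rawMonoid using (sum)

  ℝ^_ : ℕ → Set
  ℝ^ k = Vector Carrier k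

  infixl 7 _·_

  _·_ : ∀ {k} → ℝ^ k → ℝ^ k → Carrier
  c · x = sum (λ i → c i * x i)

  𝟎 : ∀ {k} → ℝ^ k
  𝟎 = replicate _ 0#

  𝟏 : ∀ {k} → ℝ^ k
  𝟏 = replicate _ 1#

  -- Taking c = 𝟎 and b = 0# shows that P is a face of itself when nonempty;
  -- the empty face is excluded.
  IsFace : ∀ {k} → Pred (ℝ^ k) 0ℓ → Pred (ℝ^ k) 0ℓ → Set
  IsFace {k} P F =
    Satisfiable F ×
    (Σ[ c ∈ ℝ^ k ] Σ[ b ∈ Carrier ]
      (∀ x → x ∈ P → c · x ≤ b) ×
      F ≐ P ∩ (λ x → c · x ≈ b))

  record Face {k} (P : Pred (ℝ^ k) 0ℓ) : Set (suc 0ℓ) where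
    field
      points : Pred (ℝ^ k) 0ℓ
      isFace : IsFace P points

  open Face public

  facePoset : ∀ {k} → Pred (ℝ^ k) 0ℓ → Poset (suc 0ℓ) 0ℓ 0ℓ
  facePoset {k} P = On.poset (⊆-poset (ℝ^ k) 0ℓ) (points {P = P})

  faceFigure : ∀ {k} {P : Pred (ℝ^ k) 0ℓ} → Face P → Poset (suc 0ℓ) 0ℓ 0ℓ
  faceFigure {P = P} F =
    On.poset (facePoset P) (proj₁ {B = λ (G : Face P) → points F ⊆ points G})

  IsMinimalFaceContaining : ∀ {k} {P : Pred (ℝ^ k) 0ℓ} →
                            ℝ^ k → ℝ^ k → Face P → Set (suc 0ℓ)
  IsMinimalFaceContaining {P = P} u v F =
    u ∈ points F × v ∈ points F ×
    (∀ (G : Face P) → u ∈ points G → v ∈ points G →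
      points G ⊆ points F → points F ⊆ points G)

  braidCone : ∀ {k} → Digraph k → Pred (ℝ^ k) 0ℓ
  braidCone Γ x = ∀ {i j} → Digraph.Arc Γ i j → x i ≤ x j

  unitCube : ∀ {k} → Pred (ℝ^ k) 0ℓ
  unitCube x = ∀ i → 0# ≤ x i × x i ≤ 1#

  Ord : ∀ {k} → Digraph k → Pred (ℝ^ k) 0ℓ
  Ord Γ = braidCone Γ ∩ unitCube

{-# OPTIONS --safe #-}

-- Translation by ±𝟏 and dilation preserve the braid cone, so each of its faces
-- is cut out by a hyperplane c · x = 0 with c · 𝟏 = 0.  A face of the order
-- polytope is of this form exactly when it contains 𝟎 and 𝟏.  Every point of the
-- braid cone can be moved into the unit cube by x ↦ t (x + l 𝟏) with t > 0, which
-- leaves the sign of such a functional unchanged; hence the two kinds of faces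
-- are given by the same functionals.
--
-- The points of Ord Γ that are constant along arcs form a face, and it lies in
-- every face containing 𝟎 and 𝟏: with x it contains 𝟏 - x, and 𝟏 is their sum.

module Submission where

open import Defs
open import Data.Fin.Base using (Fin; zero; suc)
open import Data.List.Base using (tabulate)
open import Data.List.Relation.Unary.All.Properties using (tabulate⁻)
import Data.List.Extrema as Extrema
open import Data.Nat.Base using (ℕ)
open import Data.Product using (Σ-syntax; ∃-syntax; ∃!; _×_; _,_; proj₁; proj₂)
open import Data.Sum.Base using (inj₁; inj₂)
open import Data.Vec.Functional using (head; tail; replicate; _∷_)
open import Function.Base using (_∘_)
open import Level using (0ℓ)
open import Relation.Binary.Bundles using (Poset; TotalOrder)
open import Relation.Binary.Morphism.Structures using (IsOrderIsomorphism)
open import Relation.Nullary.Decidable.Core using (yes; no)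
open import Relation.Nullary.Negation.Core using (contradiction)
open import Relation.Unary using (Pred; _∈_; _⊆_; _≐_; _∩_)

-- Inequalities in a totally ordered field.

module OrderedField (R : RealNumbers) where

  open RealNumbers R using (commutativeRing; _≤_; isTotalOrder; 0≉1; inverse; +-monoʳ-≤; *-nonNeg)
  open import Algebra.Bundles using (CommutativeRing)
  open CommutativeRing commutativeRing hiding (zero)
  open import Algebra.Properties.Ring ring using (-‿distribˡ-*; -‿distribʳ-*)
  open import Algebra.Properties.Group +-group
    using (⁻¹-involutive; //-rightDividesʳ; //-rightDividesˡ)

  totalOrder : TotalOrder 0ℓ 0ℓ 0ℓ
  totalOrder = record { isTotalOrder = isTotalOrder }

  open TotalOrder totalOrder public
    using (poset; total; antisym; ≤-respˡ-≈; ≤-respʳ-≈)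
    renaming (refl to ≤-refl; reflexive to ≤-reflexive; trans to ≤-trans)

  open import Relation.Binary.Reasoning.PartialOrder poset

  +-monoˡ-≤ : ∀ x {y z} → y ≤ z → y + x ≤ z + x
  +-monoˡ-≤ x {y} {z} y≤z = begin
    y + x  ≈⟨ +-comm y x ⟩
    x + y  ≤⟨ +-monoʳ-≤ x y≤z ⟩
    x + z  ≈⟨ +-comm x z ⟩
    z + x  ∎

  +-mono-≤ : ∀ {x y u v} → x ≤ y → u ≤ v → x + u ≤ y + v
  +-mono-≤ x≤y u≤v = ≤-trans (+-monoˡ-≤ _ x≤y) (+-monoʳ-≤ _ u≤v)

  +-cancelʳ-≤ : ∀ z {x y} → x + z ≤ y + z → x ≤ y
  +-cancelʳ-≤ z {x} {y} x+z≤y+z = begin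
    x          ≈⟨ //-rightDividesʳ z x ⟨
    x + z - z  ≤⟨ +-monoˡ-≤ (- z) x+z≤y+z ⟩
    y + z - z  ≈⟨ //-rightDividesʳ z y ⟩
    y          ∎

  x≤y⇒0≤y-x : ∀ {x y} → x ≤ y → 0# ≤ y - x
  x≤y⇒0≤y-x {x} {y} x≤y = begin
    0#     ≈⟨ -‿inverseʳ x ⟨
    x - x  ≤⟨ +-monoˡ-≤ (- x) x≤y ⟩
    y - x  ∎

  0≤y-x⇒x≤y : ∀ {x y} → 0# ≤ y - x → x ≤ y
  0≤y-x⇒x≤y {x} {y} 0≤y-x = begin
    x          ≈⟨ +-identityˡ x ⟨
    0# + x     ≤⟨ +-monoˡ-≤ x 0≤y-x ⟩
    y - x + x  ≈⟨ //-rightDividesˡ x y ⟩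
    y          ∎

  x≤y⇒x-y≤0 : ∀ {x y} → x ≤ y → x - y ≤ 0#
  x≤y⇒x-y≤0 {x} {y} x≤y = begin
    x - y  ≤⟨ +-monoˡ-≤ (- y) x≤y ⟩
    y - y  ≈⟨ -‿inverseʳ y ⟩
    0#     ∎

  0≤x⇒y-x≤y : ∀ {x y} → 0# ≤ x → y - x ≤ y
  0≤x⇒y-x≤y {x} {y} 0≤x = +-cancelʳ-≤ x (begin
    y - x + x  ≈⟨ //-rightDividesˡ x y ⟩
    y          ≈⟨ +-identityʳ y ⟨
    y + 0#     ≤⟨ +-monoʳ-≤ y 0≤x ⟩
    y + x      ∎)

  x+x≤x⇒x≤0 : ∀ {x} → x + x ≤ x → x ≤ 0#
  x+x≤x⇒x≤0 {x} x+x≤x = +-cancelʳ-≤ x (≤-respʳ-≈ (sym (+-identityˡ x)) x+x≤x)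

  -- Slack in `x ≤ a` could only be made up by `y` exceeding `b`. This splits a tight sum of two
  -- valid inequalities into two tight ones, whether two functionals or two points are added.
  +-tightˡ : ∀ {x y a b} → x ≤ a → y ≤ b → x + y ≈ a + b → x ≈ a
  +-tightˡ {x} {y} {a} {b} x≤a y≤b x+y≈a+b = antisym x≤a (+-cancelʳ-≤ b (begin
    a + b  ≈⟨ x+y≈a+b ⟨
    x + y  ≤⟨ +-monoʳ-≤ x y≤b ⟩
    x + b  ∎))

  +-tightʳ : ∀ {x y a b} → x ≤ a → y ≤ b → x + y ≈ a + b → y ≈ b
  +-tightʳ x≤a y≤b x+y≈a+b =
    +-tightˡ y≤b x≤a (trans (+-comm _ _) (trans x+y≈a+b (+-comm _ _)))

  *-monoʳ-≤ : ∀ {t} → 0# ≤ t → ∀ {x y} → x ≤ y → t * x ≤ t * y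
  *-monoʳ-≤ {t} 0≤t {x} {y} x≤y = 0≤y-x⇒x≤y (begin
    0#               ≤⟨ *-nonNeg 0≤t (x≤y⇒0≤y-x x≤y) ⟩
    t * (y - x)      ≈⟨ distribˡ t y (- x) ⟩
    t * y + t * - x  ≈⟨ +-congˡ (-‿distribʳ-* t x) ⟨
    t * y - t * x    ∎)

  x²≥0 : ∀ x → 0# ≤ x * x
  x²≥0 x with total 0# x
  ... | inj₁ 0≤x = *-nonNeg 0≤x 0≤x
  ... | inj₂ x≤0 = begin
    0#           ≤⟨ *-nonNeg 0≤-x 0≤-x ⟩
    - x * - x    ≈⟨ -‿distribˡ-* x (- x) ⟨
    - (x * - x)  ≈⟨ -‿cong (-‿distribʳ-* x x) ⟨
    - - (x * x)  ≈⟨ ⁻¹-involutive (x * x) ⟩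
    x * x        ∎
    where
    0≤-x : 0# ≤ - x
    0≤-x = ≤-respʳ-≈ (+-identityˡ (- x)) (x≤y⇒0≤y-x x≤0)

  0≤1 : 0# ≤ 1#
  0≤1 = ≤-respʳ-≈ (*-identityˡ 1#) (x²≥0 1#)

  x≥1⇒inverse : ∀ {x} → 1# ≤ x → ∃[ y ] 0# ≤ y × x * y ≈ 1#
  x≥1⇒inverse {x} 1≤x = y , 0≤y , xy≈1
    where
    x≉0 = λ x≈0 → 0≉1 (antisym 0≤1 (≤-respʳ-≈ x≈0 1≤x))
    y = proj₁ (inverse x x≉0)
    xy≈1 = proj₂ (inverse x x≉0)
    0≤y : 0# ≤ y
    0≤y = begin
      -- The inverse `y` equals `x * (y * y)`, a product of nonnegative factors.
      0#           ≤⟨ *-nonNeg (≤-trans 0≤1 1≤x) (x²≥0 y) ⟩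
      x * (y * y)  ≈⟨ *-assoc x y y ⟨
      x * y * y    ≈⟨ *-congʳ xy≈1 ⟩
      1# * y       ≈⟨ *-identityˡ y ⟩
      y            ∎

module Faces (R : RealNumbers) where

  open RealNumbers R using (commutativeRing; _≤_; *-nonNeg; +-monoʳ-≤)
  open Polyhedra R
  open OrderedField R
  open import Algebra.Bundles using (CommutativeRing)
  open CommutativeRing commutativeRing hiding (zero)
  open import Algebra.Properties.CommutativeMonoid.Sum +-commutativeMonoid
    using (sum-cong-≋; ∑-distrib-+)
  open import Algebra.Properties.Semiring.Sum semiring using (*-distribˡ-sum)
  open import Algebra.Properties.Ring ring using (-1*x≈-x)
  open import Algebra.Properties.Group +-group using (x∙y⁻¹≈ε⇒x≈y; x≈y⇒x∙y⁻¹≈ε)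
  open import Algebra.Properties.AbelianGroup +-abelianGroup using (xyx⁻¹≈y)
  open import Relation.Binary.Reasoning.PartialOrder poset

  -- Linear functionals.

  ·-congˡ : ∀ {k} (c : ℝ^ k) {x y : ℝ^ k} → (∀ i → x i ≈ y i) → c · x ≈ c · y
  ·-congˡ c x≈y = sum-cong-≋ (λ i → *-congˡ (x≈y i))

  ·-comm : ∀ {k} (c x : ℝ^ k) → c · x ≈ x · c
  ·-comm c x = sum-cong-≋ (λ i → *-comm (c i) (x i))

  ·-distribˡ-+ : ∀ {k} (c x y : ℝ^ k) → c · (λ i → x i + y i) ≈ c · x + c · y
  ·-distribˡ-+ c x y = trans (sum-cong-≋ (λ i → distribˡ (c i) (x i) (y i)))
                             (∑-distrib-+ (λ i → c i * x i) (λ i → c i * y i))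

  ·-distribʳ-+ : ∀ {k} (x c d : ℝ^ k) → (λ i → c i + d i) · x ≈ c · x + d · x
  ·-distribʳ-+ x c d = trans (·-comm (λ i → c i + d i) x)
    (trans (·-distribˡ-+ x c d) (+-cong (·-comm x c) (·-comm x d)))

  ·-scaleʳ : ∀ {k} (c : ℝ^ k) t (x : ℝ^ k) → c · (λ i → t * x i) ≈ t * (c · x)
  ·-scaleʳ c t x = trans (sum-cong-≋ (λ i → x*ty≈t*xy (c i) (x i)))
                         (sym (*-distribˡ-sum t (λ i → c i * x i)))
    where
    x*ty≈t*xy : ∀ x y → x * (t * y) ≈ t * (x * y)
    x*ty≈t*xy x y = trans (sym (*-assoc x t y)) (trans (*-congʳ (*-comm x t)) (*-assoc t x y))

  ·-constant : ∀ {k} (c : ℝ^ k) t → c · replicate k t ≈ t * (c · 𝟏)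
  ·-constant c t = trans (·-congˡ c (λ _ → sym (*-identityʳ t))) (·-scaleʳ c t 𝟏)

  ·-zeroʳ : ∀ {k} (c : ℝ^ k) → c · 𝟎 ≈ 0#
  ·-zeroʳ c = trans (·-constant c 0#) (zeroˡ (c · 𝟏))

  ·-zeroˡ : ∀ {k} (x : ℝ^ k) → 𝟎 · x ≈ 0#
  ·-zeroˡ x = trans (·-comm 𝟎 x) (·-zeroʳ x)

  -- The multiple `a` of the `i`-th standard basis vector, by recursion on `i` so that `sum` unfolds
  -- along it.
  single : ∀ {k} → Fin k → Carrier → ℝ^ k
  single zero    a = a ∷ 𝟎
  single (suc i) a = 0# ∷ single i a

  single-· : ∀ {k} (i : Fin k) a (x : ℝ^ k) → single i a · x ≈ a * x i
  single-· zero    a x = trans (+-congˡ (·-zeroˡ (tail x))) (+-identityʳ (a * head x))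
  single-· (suc i) a x = trans (+-cong (zeroˡ (head x)) (single-· i a (tail x)))
                               (+-identityˡ (a * tail x i))

  -- Moving points into the unit cube.

  bounded : ∀ {k} (x : ℝ^ k) → ∃[ m ] 0# ≤ m × (∀ i → x i ≤ m)
  -- The default `0#` makes the bound nonnegative and also covers `k = 0`.
  bounded x = max 0# (tabulate x) , ⊥≤max 0# (tabulate x) , tabulate⁻ (xs≤max 0# (tabulate x))
    where open Extrema totalOrder using (max; ⊥≤max; xs≤max)

  -- Functionals vanishing on `𝟏` do not see the translation, so between `x` and `image` their
  -- values change only by a factor: `t` one way, `s` back. Since `0# ≤ s`, inequalities can be
  -- pulled back to `x`.
  record CubeRescaling {k} (x : ℝ^ k) : Set₁ where
    field
      image      : ℝ^ k
      ∈cube      : image ∈ unitCube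
      ∈braidCone : ∀ Γ → x ∈ braidCone Γ → image ∈ braidCone Γ
      s t        : Carrier
      0≤s        : 0# ≤ s
      ·-image    : ∀ c → c · 𝟏 ≈ 0# → c · image ≈ t * (c · x)
      ·-preimage : ∀ c → c · 𝟏 ≈ 0# → c · x ≈ s * (c · image)

    ·-image≈0 : ∀ c → c · 𝟏 ≈ 0# → c · x ≈ 0# → c · image ≈ 0#
    ·-image≈0 c c𝟏≈0 cx≈0 = trans (·-image c c𝟏≈0) (trans (*-congˡ cx≈0) (zeroʳ t))

    ·-preimage≈0 : ∀ c → c · 𝟏 ≈ 0# → c · image ≈ 0# → c · x ≈ 0#
    ·-preimage≈0 c c𝟏≈0 cy≈0 = trans (·-preimage c c𝟏≈0) (trans (*-congˡ cy≈0) (zeroʳ s))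

    ·-preimage≤0 : ∀ c → c · 𝟏 ≈ 0# → c · image ≤ 0# → c · x ≤ 0#
    ·-preimage≤0 c c𝟏≈0 cy≤0 = begin
      c · x            ≈⟨ ·-preimage c c𝟏≈0 ⟩
      s * (c · image)  ≤⟨ *-monoʳ-≤ 0≤s cy≤0 ⟩
      s * 0#           ≈⟨ zeroʳ s ⟩
      0#               ∎

  cubeRescaling : ∀ {k} (x : ℝ^ k) → CubeRescaling x
  cubeRescaling {k} x = record
    { image      = y
    ; ∈cube      = λ i → *-nonNeg 0≤t (0≤x+l i) , y≤1 i
    ; ∈braidCone = λ _ x∈Q a → *-monoʳ-≤ 0≤t (+-monoˡ-≤ l (x∈Q a))
    ; s          = s
    ; t          = t
    ; 0≤s        = ≤-trans 0≤1 1≤s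
    ; ·-image    = ·-y
    ; ·-preimage = λ c c𝟏≈0 → begin-equality
        c · x            ≈⟨ *-identityˡ (c · x) ⟨
        1# * (c · x)     ≈⟨ *-congʳ st≈1 ⟨
        s * t * (c · x)  ≈⟨ *-assoc s t (c · x) ⟩
        s * (t * (c · x)) ≈⟨ *-congˡ (·-y c c𝟏≈0) ⟨
        s * (c · y)      ∎
    }
    where
    u = proj₁ (bounded x)
    0≤u = proj₁ (proj₂ (bounded x))
    x≤u = proj₂ (proj₂ (bounded x))
    l = proj₁ (bounded (λ i → - x i))
    0≤l = proj₁ (proj₂ (bounded (λ i → - x i)))
    -x≤l = proj₂ (proj₂ (bounded (λ i → - x i)))
    -- The entries of `x + l` lie between `0#` and `u + l`, so dividing by any positive `s` above
    -- `u + l` lands in the cube. The summand `1#` keeps `s` invertible even if `u + l` vanishes.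
    s = 1# + (u + l)

    1≤s : 1# ≤ s
    1≤s = begin
      1#              ≈⟨ +-identityʳ 1# ⟨
      1# + 0#         ≈⟨ +-congˡ (+-identityʳ 0#) ⟨
      1# + (0# + 0#)  ≤⟨ +-monoʳ-≤ 1# (+-mono-≤ 0≤u 0≤l) ⟩
      s               ∎

    t = proj₁ (x≥1⇒inverse 1≤s)
    0≤t = proj₁ (proj₂ (x≥1⇒inverse 1≤s))
    st≈1 = proj₂ (proj₂ (x≥1⇒inverse 1≤s))

    y : ℝ^ k
    y i = t * (x i + l)

    0≤x+l : ∀ i → 0# ≤ x i + l
    0≤x+l i = begin
      0#         ≈⟨ -‿inverseʳ (x i) ⟨
      x i - x i  ≤⟨ +-monoʳ-≤ (x i) (-x≤l i) ⟩
      x i + l    ∎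

    y≤1 : ∀ i → y i ≤ 1#
    y≤1 i = begin
      t * (x i + l)  ≤⟨ *-monoʳ-≤ 0≤t (+-monoˡ-≤ l (x≤u i)) ⟩
      t * (u + l)    ≈⟨ *-congˡ (+-identityˡ (u + l)) ⟨
      t * (0# + (u + l))  ≤⟨ *-monoʳ-≤ 0≤t (+-monoˡ-≤ (u + l) 0≤1) ⟩
      t * s          ≈⟨ *-comm t s ⟩
      s * t          ≈⟨ st≈1 ⟩
      1#             ∎

    ·-y : ∀ c → c · 𝟏 ≈ 0# → c · y ≈ t * (c · x)
    ·-y c c𝟏≈0 = begin-equality
      c · y                            ≈⟨ ·-scaleʳ c t (λ i → x i + l) ⟩
      t * (c · (λ i → x i + l))        ≈⟨ *-congˡ (·-distribˡ-+ c x (replicate k l)) ⟩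
      t * (c · x + c · replicate k l)  ≈⟨ *-congˡ (+-congˡ (·-constant c l)) ⟩
      t * (c · x + l * (c · 𝟏))        ≈⟨ *-congˡ (+-congˡ (trans (*-congˡ c𝟏≈0) (zeroʳ l))) ⟩
      t * (c · x + 0#)                 ≈⟨ *-congˡ (+-identityʳ (c · x)) ⟩
      t * (c · x)                      ∎

  -- Intersections of faces, and faces with a central hyperplane.

  isFace-resp-≐ : ∀ {k} {P F G : Pred (ℝ^ k) 0ℓ} → F ≐ G → IsFace P F → IsFace P G
  isFace-resp-≐ (F⊆G , G⊆F) ((x , x∈F) , c , b , c≤b , F⊆ , ⊆F) =
    (x , F⊆G x∈F) , c , b , c≤b , (λ x∈G → F⊆ (G⊆F x∈G)) , (λ p → F⊆G (⊆F p))

  isFace-refl : ∀ {k} {P : Pred (ℝ^ k) 0ℓ} {x} → x ∈ P → IsFace P P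
  isFace-refl {x = x} x∈P = (x , x∈P) , 𝟎 , 0# , (λ y _ → ≤-reflexive (·-zeroˡ y)) ,
    (λ {y} y∈P → y∈P , ·-zeroˡ y) , proj₁

  -- The sum of the two normals is bounded by the sum of the two levels, and attains it only where
  -- both inequalities are tight. The common point `x` witnesses nonemptiness.
  isFace-∩ : ∀ {k} {P F G : Pred (ℝ^ k) 0ℓ} {x} → x ∈ F ∩ G →
             IsFace P F → IsFace P G → IsFace P (F ∩ G)
  isFace-∩ {x = x} x∈F∩G (_ , c , a , c≤a , F⊆ , ⊆F) (_ , d , b , d≤b , G⊆ , ⊆G) =
    (x , x∈F∩G) , (λ i → c i + d i) , a + b ,
    (λ y y∈P → ≤-respˡ-≈ (sym (·-distribʳ-+ y c d)) (+-mono-≤ (c≤a y y∈P) (d≤b y y∈P))) ,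
    (λ {y} (y∈F , y∈G) → proj₁ (F⊆ y∈F) ,
      trans (·-distribʳ-+ y c d) (+-cong (proj₂ (F⊆ y∈F)) (proj₂ (G⊆ y∈G)))) ,
    (λ {y} (y∈P , eq) →
      let eq′ = trans (sym (·-distribʳ-+ y c d)) eq in
      ⊆F (y∈P , +-tightˡ (c≤a y y∈P) (d≤b y y∈P) eq′) ,
      ⊆G (y∈P , +-tightʳ (c≤a y y∈P) (d≤b y y∈P) eq′))

  -- Intersecting with `P` makes the empty family yield `P` itself, the base case of the induction.
  isFace-⋂ : ∀ {k n} {P : Pred (ℝ^ k) 0ℓ} (F : Fin n → Pred (ℝ^ k) 0ℓ) {x} →
             x ∈ P → (∀ i → x ∈ F i) → (∀ i → IsFace P (F i)) →
             IsFace P (P ∩ (λ y → ∀ i → y ∈ F i))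
  isFace-⋂ {n = ℕ.zero} F x∈P x∈F faces =
    isFace-resp-≐ ((λ y∈P → y∈P , λ ()) , proj₁) (isFace-refl x∈P)
  isFace-⋂ {n = ℕ.suc n} F x∈P x∈F faces =
    isFace-resp-≐
      ( (λ (y∈F₀ , y∈P , y∈F) → y∈P , λ { zero → y∈F₀ ; (suc i) → y∈F i })
      , (λ (y∈P , y∈F) → y∈F zero , y∈P , y∈F ∘ suc))
      (isFace-∩ (x∈F zero , x∈P , x∈F ∘ suc) (faces zero)
                (isFace-⋂ (F ∘ suc) x∈P (x∈F ∘ suc) (faces ∘ suc)))

  -- The supporting hyperplane contains the whole line spanned by `𝟏`. This common form is what
  -- passes between the cone and the polytope with the normal unchanged.
  record IsCentralFace {k} (P F : Pred (ℝ^ k) 0ℓ) : Set where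
    field
      normal  : ℝ^ k
      ·𝟏      : normal · 𝟏 ≈ 0#
      valid   : ∀ x → x ∈ P → normal · x ≤ 0#
      support : F ≐ P ∩ (λ x → normal · x ≈ 0#)

  central⇒isFace : ∀ {k} {P F : Pred (ℝ^ k) 0ℓ} → 𝟎 ∈ P → IsCentralFace P F → IsFace P F
  central⇒isFace 𝟎∈P C = (𝟎 , proj₂ support (𝟎∈P , ·-zeroʳ normal)) , normal , 0# , valid , support
    where open IsCentralFace C

  -- The point `𝟎` on the hyperplane forces the level `b` to be zero, and then `𝟏` on it forces
  -- `c · 𝟏 ≈ 0#`.
  isFace⇒central : ∀ {k} {P F : Pred (ℝ^ k) 0ℓ} → 𝟎 ∈ F → 𝟏 ∈ F → IsFace P F → IsCentralFace P F
  isFace⇒central 𝟎∈F 𝟏∈F (_ , c , b , c≤b , F⊆ , ⊆F) = record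
    { normal  = c
    ; ·𝟏      = trans (proj₂ (F⊆ 𝟏∈F)) b≈0
    ; valid   = λ x x∈P → ≤-respʳ-≈ b≈0 (c≤b x x∈P)
    ; support = (λ x∈F → proj₁ (F⊆ x∈F) , trans (proj₂ (F⊆ x∈F)) b≈0)
              , (λ (x∈P , cx≈0) → ⊆F (x∈P , trans cx≈0 (sym b≈0)))
    }
    where
    b≈0 : b ≈ 0#
    b≈0 = trans (sym (proj₂ (F⊆ 𝟎∈F))) (·-zeroʳ c)

  -- Faces of the braid cone against faces of the order polytope.

  module _ {k} (Γ : Digraph k) where

    open Digraph Γ

    constant∈braidCone : ∀ a → replicate k a ∈ braidCone Γ
    constant∈braidCone a _ = ≤-refl

    𝟎∈Ord : 𝟎 ∈ Ord Γ
    𝟎∈Ord = constant∈braidCone 0# , λ _ → ≤-refl , 0≤1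

    𝟏∈Ord : 𝟏 ∈ Ord Γ
    𝟏∈Ord = constant∈braidCone 1# , λ _ → 0≤1 , ≤-refl

    braidCone-face-central : ∀ {F} → IsFace (braidCone Γ) F → IsCentralFace (braidCone Γ) F
    braidCone-face-central ((x , x∈F) , c , b , c≤b , F⊆ , ⊆F) =
      isFace⇒central (⊆F (constant∈braidCone 0# , trans (·-zeroʳ c) (sym b≈0)))
                     (⊆F (constant∈braidCone 1# , trans c𝟏≈0 (sym b≈0)))
                     ((x , x∈F) , c , b , c≤b , F⊆ , ⊆F)
      where
      x∈Q : x ∈ braidCone Γ
      x∈Q = proj₁ (F⊆ x∈F)

      cx≈b : c · x ≈ b
      cx≈b = proj₂ (F⊆ x∈F)

      b≈0 : b ≈ 0#
      -- Doubling a point of the face stays in the cone, so `b + b ≤ b`; the point `𝟎` gives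
      -- `0# ≤ b`.
      b≈0 = antisym
        (x+x≤x⇒x≤0 (begin
          b + b                  ≈⟨ +-cong cx≈b cx≈b ⟨
          c · x + c · x          ≈⟨ ·-distribˡ-+ c x x ⟨
          c · (λ i → x i + x i)  ≤⟨ c≤b _ (λ a → +-mono-≤ (x∈Q a) (x∈Q a)) ⟩
          b                      ∎))
        (≤-respˡ-≈ (·-zeroʳ c) (c≤b 𝟎 (constant∈braidCone 0#)))

      c·constant≤0 : ∀ a → c · replicate k a ≤ 0#
      c·constant≤0 a = ≤-respʳ-≈ b≈0 (c≤b _ (constant∈braidCone a))

      c𝟏≈0 : c · 𝟏 ≈ 0#
      -- Both `𝟏` and its negative lie in the cone, so `c` is nonpositive on each, while the two
      -- values sum to zero.
      c𝟏≈0 = +-tightˡ (c·constant≤0 1#) (c·constant≤0 (- 1#)) (begin-equality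
        c · 𝟏 + c · replicate k (- 1#)  ≈⟨ ·-distribˡ-+ c 𝟏 (replicate k (- 1#)) ⟨
        c · replicate k (1# - 1#)       ≈⟨ ·-congˡ c (λ _ → -‿inverseʳ 1#) ⟩
        c · 𝟎                           ≈⟨ ·-zeroʳ c ⟩
        0#                              ≈⟨ +-identityʳ 0# ⟨
        0# + 0#                         ∎)

    restrict-central : ∀ {F} → IsCentralFace (braidCone Γ) F →
                       IsCentralFace (Ord Γ) (F ∩ unitCube)
    restrict-central C = record
      { normal  = normal
      ; ·𝟏      = ·𝟏
      ; valid   = λ x (x∈Q , _) → valid x x∈Q
      ; support = (λ (x∈F , x∈I) → let (x∈Q , cx≈0) = proj₁ support x∈F in (x∈Q , x∈I) , cx≈0)
                , (λ ((x∈Q , x∈I) , cx≈0) → proj₂ support (x∈Q , cx≈0) , x∈I)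
      }
      where open IsCentralFace C

    -- The same normal works on the cone. Its inequality is given only inside the cube; a point of
    -- the cone is rescaled into the cube and the inequality pulled back.
    extend-central : ∀ {G} → IsCentralFace (Ord Γ) G →
                     Σ[ F ∈ Face (braidCone Γ) ] points F ∩ unitCube ≐ G
    extend-central C =
      record
        { points = braidCone Γ ∩ (λ x → normal · x ≈ 0#)
        ; isFace = central⇒isFace {P = braidCone Γ} (constant∈braidCone 0#) (record
            { normal = normal ; ·𝟏 = ·𝟏 ; valid = valid′ ; support = (λ p → p) , (λ p → p) })
        } ,
      (λ ((x∈Q , cx≈0) , x∈I) → proj₂ support ((x∈Q , x∈I) , cx≈0)) ,
      (λ x∈G → let ((x∈Q , x∈I) , cx≈0) = proj₁ support x∈G in (x∈Q , cx≈0) , x∈I)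
      where
      open IsCentralFace C
      valid′ : ∀ x → x ∈ braidCone Γ → normal · x ≤ 0#
      valid′ x x∈Q = ·-preimage≤0 normal ·𝟏 (valid image (∈braidCone Γ x∈Q , ∈cube))
        where open CubeRescaling (cubeRescaling x)

    -- Rescaling a point of `F` into the cube preserves the vanishing of the normal of `F`, so the
    -- image lies in `F` and hence in `G`; the vanishing of the normal of `G` then pulls back to the
    -- original point.
    restrict-cancel : (F G : Face (braidCone Γ)) →
                      points F ∩ unitCube ⊆ points G ∩ unitCube → points F ⊆ points G
    restrict-cancel F G F∩I⊆G∩I {x} x∈F =
      let x∈Q , cx≈0 = proj₁ F.support x∈F
          y∈F        = proj₂ F.support (∈braidCone Γ x∈Q , ·-image≈0 F.normal F.·𝟏 cx≈0)
          y∈G        = proj₁ (F∩I⊆G∩I (y∈F , ∈cube))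
          dy≈0       = proj₂ (proj₁ G.support y∈G)
      in proj₂ G.support (x∈Q , ·-preimage≈0 G.normal G.·𝟏 dy≈0)
      where
      module F = IsCentralFace (braidCone-face-central (isFace F))
      module G = IsCentralFace (braidCone-face-central (isFace G))
      open CubeRescaling (cubeRescaling x)

    -- The minimal face containing `𝟎` and `𝟏`.

    AlongArc : Fin k → Fin k → Pred (ℝ^ k) 0ℓ
    AlongArc i j x = Arc i j → x i ≈ x j

    -- An arc gives the functional `x i - x j`, nonpositive on the polytope. For a non-arc the
    -- condition is vacuous and the face is the whole polytope, so all pairs of nodes can be
    -- intersected uniformly.
    isFace-arc : ∀ i j → IsFace (Ord Γ) (Ord Γ ∩ AlongArc i j)
    isFace-arc i j with arc? i j
    ... | no ¬a = isFace-resp-≐ ((λ x∈P → x∈P , λ a → contradiction a ¬a) , proj₁) (isFace-refl 𝟎∈Ord)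
    ... | yes a = (𝟎 , 𝟎∈Ord , λ _ → refl) , c , 0# ,
      (λ x (x∈Q , _) → ≤-respˡ-≈ (sym (c· x)) (x≤y⇒x-y≤0 (x∈Q a))) ,
      (λ {x} (x∈P , x≈) → x∈P , trans (c· x) (x≈y⇒x∙y⁻¹≈ε (x≈ a))) ,
      (λ {x} (x∈P , cx≈0) → x∈P , λ _ → x∙y⁻¹≈ε⇒x≈y _ _ (trans (sym (c· x)) cx≈0))
      where
      c : ℝ^ k
      c l = single i 1# l + single j (- 1#) l
      c· : ∀ x → c · x ≈ x i - x j
      c· x = begin-equality
        c · x                                ≈⟨ ·-distribʳ-+ x (single i 1#) (single j (- 1#)) ⟩
        single i 1# · x + single j (- 1#) · x ≈⟨ +-cong (single-· i 1# x) (single-· j (- 1#) x) ⟩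
        1# * x i + - 1# * x j                ≈⟨ +-cong (*-identityˡ (x i)) (-1*x≈-x (x j)) ⟩
        x i - x j                            ∎

    minimalFace : Face (Ord Γ)
    minimalFace = record
      { points = Ord Γ ∩ (λ x → ∀ i j → AlongArc i j x)
      ; isFace = isFace-resp-≐
          -- The nested intersections over `i` and `j` repeat membership in `Ord Γ` at each level;
          -- these maps drop and restore the copies.
          ((λ (x∈P , p) → x∈P , λ i j → proj₂ (proj₂ (p i) j)) ,
           (λ (x∈P , p) → x∈P , λ i → x∈P , λ j → x∈P , p i j))
          (isFace-⋂ _ 𝟎∈Ord (λ _ → 𝟎∈Ord , λ _ → 𝟎∈Ord , λ _ → refl)
            (λ i → isFace-⋂ _ 𝟎∈Ord (λ _ → 𝟎∈Ord , λ _ → refl) (isFace-arc i)))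
      }

    𝟎∈minimalFace : 𝟎 ∈ points minimalFace
    𝟎∈minimalFace = 𝟎∈Ord , λ _ _ _ → refl

    𝟏∈minimalFace : 𝟏 ∈ points minimalFace
    𝟏∈minimalFace = 𝟏∈Ord , λ _ _ _ → refl

    minimalFace⊆ : (G : Face (Ord Γ)) → 𝟎 ∈ points G → 𝟏 ∈ points G → points minimalFace ⊆ points G
    minimalFace⊆ G 𝟎∈G 𝟏∈G {x} ((x∈Q , x∈I) , x≈) =
      proj₂ support ((x∈Q , x∈I) ,
        -- The normal is nonpositive at `x` and at `𝟏 - x`, and the two values sum to zero, so both
        -- vanish.
        +-tightˡ (valid x (x∈Q , x∈I)) (valid y y∈Ord) (begin-equality
          normal · x + normal · y      ≈⟨ ·-distribˡ-+ normal x y ⟨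
          normal · (λ i → x i + y i)   ≈⟨ ·-congˡ normal (λ i → x+[a-x]≈a (x i) 1#) ⟩
          normal · 𝟏                   ≈⟨ ·𝟏 ⟩
          0#                           ≈⟨ +-identityʳ 0# ⟨
          0# + 0#                      ∎))
      where
      open IsCentralFace (isFace⇒central 𝟎∈G 𝟏∈G (isFace G))
      x+[a-x]≈a : ∀ x a → x + (a - x) ≈ a
      x+[a-x]≈a x a = trans (sym (+-assoc x a (- x))) (xyx⁻¹≈y x a)
      y : ℝ^ k
      y i = 1# - x i
      y∈Ord : y ∈ Ord Γ
      -- Reflection reverses the arc inequalities; `y` stays in the cone because they are equalities
      -- for `x`.
      y∈Ord = (λ a → ≤-reflexive (+-congˡ (-‿cong (x≈ _ _ a)))) ,
              (λ i → x≤y⇒0≤y-x (proj₂ (x∈I i)) , 0≤x⇒y-x≤y (proj₁ (x∈I i)))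

    minimalFace-isMinimal : IsMinimalFaceContaining 𝟎 𝟏 minimalFace
    minimalFace-isMinimal = 𝟎∈minimalFace , 𝟏∈minimalFace , λ G 𝟎∈G 𝟏∈G _ → minimalFace⊆ G 𝟎∈G 𝟏∈G

    -- Minimality of `F` compares it only with faces inside it, and `minimalFace⊆` shows that
    -- `minimalFace` is one of them.
    minimalFace-unique : ∀ {F} → IsMinimalFaceContaining 𝟎 𝟏 F → points minimalFace ≐ points F
    minimalFace-unique {F} (𝟎∈F , 𝟏∈F , minimal) =
      min⊆F , minimal minimalFace 𝟎∈minimalFace 𝟏∈minimalFace min⊆F
      where
      min⊆F : points minimalFace ⊆ points F
      min⊆F = minimalFace⊆ F 𝟎∈F 𝟏∈F

    -- The map to the face figure and its inverse.

    restrict : Face (braidCone Γ) → Face (Ord Γ)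
    restrict F = record
      { points = points F ∩ unitCube
      ; isFace = central⇒isFace 𝟎∈Ord (restrict-central (braidCone-face-central (isFace F)))
      }

    minimalFace⊆restrict : ∀ F → points minimalFace ⊆ points (restrict F)
    minimalFace⊆restrict F = minimalFace⊆ (restrict F)
      (proj₂ support (𝟎∈Ord , ·-zeroʳ normal)) (proj₂ support (𝟏∈Ord , ·𝟏))
      where open IsCentralFace (restrict-central (braidCone-face-central (isFace F)))

lemma10 :
    (R : RealNumbers) → let open Polyhedra R in
    (k : ℕ) (Γ : Digraph k) → Acyclic Γ →
    ∃! (Poset._≈_ (facePoset (Ord Γ))) (IsMinimalFaceContaining 𝟎 𝟏) ×
    ((F₀₁ : Face (Ord Γ)) → IsMinimalFaceContaining 𝟎 𝟏 F₀₁ →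
      let module Q = Poset (facePoset (braidCone Γ))
          module 𝓕₀₁ = Poset (faceFigure F₀₁)
      in
      Σ[ κ ∈ (Q.Carrier → 𝓕₀₁.Carrier) ]
        (∀ F → points (proj₁ (κ F)) ≐ points F ∩ unitCube) ×
        IsOrderIsomorphism Q._≈_ 𝓕₀₁._≈_ Q._≤_ 𝓕₀₁._≤_ κ)
lemma10 R k Γ _ =
  (minimalFace Γ , minimalFace-isMinimal Γ , λ {F} → minimalFace-unique Γ {F}) ,
  λ F₀₁ F₀₁-min@(𝟎∈F₀₁ , 𝟏∈F₀₁ , _) →
    -- The given `F₀₁` has the same points as `minimalFace`, so it too lies in every restricted
    -- face.
    let min⊆F₀₁ , F₀₁⊆min = minimalFace-unique Γ {F₀₁} F₀₁-min in
    (λ F → restrict Γ F , λ x∈F₀₁ → minimalFace⊆restrict Γ F (F₀₁⊆min x∈F₀₁)) ,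
    (λ F → (λ p → p) , (λ p → p)) ,
    record
      { isOrderMonomorphism = record
        { isOrderHomomorphism = record
          { cong = λ (F⊆G , G⊆F) → (λ (x∈F , x∈I) → F⊆G x∈F , x∈I) , (λ (x∈G , x∈I) → G⊆F x∈G , x∈I)
          ; mono = λ F⊆G (x∈F , x∈I) → F⊆G x∈F , x∈I
          }
        ; injective = λ {F} {G} (F⊆G , G⊆F) → restrict-cancel Γ F G F⊆G , restrict-cancel Γ G F G⊆F
        ; cancel = λ {F} {G} → restrict-cancel Γ F G
        }
      -- A face above `F₀₁` contains `𝟎` and `𝟏`, hence is central and extends to the cone. The
      -- preimage is taken up to equality of point sets, hence the extra face `H`.
      ; surjective = λ (G , F₀₁⊆G) →
          let F , F∩I⊆G , G⊆F∩I =
                extend-central Γ (isFace⇒central (F₀₁⊆G 𝟎∈F₀₁) (F₀₁⊆G 𝟏∈F₀₁) (isFace G))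
          in F , λ (H⊆F , F⊆H) →
               (λ (x∈H , x∈I) → F∩I⊆G (H⊆F x∈H , x∈I)) ,
               (λ x∈G → let x∈F , x∈I = G⊆F∩I x∈G in F⊆H x∈F , x∈I)
      }
  where
  open Polyhedra R
  open Faces R
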